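{- For $m\ge 3$, the Sperner systems $\mathcal{M}^m_1$ and $\mathcal{M}^m_2$ are nonisomorphic and strongly hypomorphic with respect to the reconstruction problem for hypergraphs and vertex-deleted subhypergraphs.
   Context: A set system over a finite set $A$ is a set of subsets of $A$, called blocks; it is a Sperner system if no block is included in another. A set system is regarded as a hypergraph with vertex set $A$ and edge set the set of blocks. Hypergraphs $G$, $H$ are isomorphic, $G\equiv H$, if there is a bijection between their vertex sets mapping the edge set of $G$ onto the edge set of $H$. For a hypergraph $G$ and vertex $v\in V(G)$, $G-v$ is the hypergraph with vertex set $V(G)\setminus\{v\}$ and edge set $\{e\in E(G):v\notin e\}$. Two hypergraphs $G,H$ on the same vertex set $V$ are strongly hypomorphic with respect to the reconstruction problem for hypergraphs and vertex-deleted subhypergraphs if $G-v\equiv H-v$ for every $v\in V$. Let $[m]=\{1,\dots,m\}$. For each $n\in[m]$ let $n'$ be a new element (a primed copy of $n$), and $S'=\{n':n\in S\}$ for $S\subseteq[m]$. Let $E_m=[m]\cup[m]'$, a set with $2m$ elements. Addition of elements of $[m]$ is modulo $m$ with result taken in $[m]$. For $J\subseteq[m]$ let $F^m_J=J\cup([m]\setminus J)'$. Put $\mathcal F^m_1=\{F^m_J: J\subseteq[m],\ |J|\text{ odd}\}$ and $\mathcal F^m_2=\{F^m_J: J\subseteq[m],\ |J|\text{ even}\}$. For $p\in[m]$ let $G^m_p=E_m\setminus\{p,p',(p+1)'\}$ and $\mathcal G^m=\{G^m_p:p\in[m]\}$. For $i\in\{1,2\}$, $\mathcal M^m_i=\mathcal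 F^m_i\cup\mathcal G^m$, a Sperner system over $E_m$. -}

module Defs where

open import Level using (0ℓ)
open import Data.Nat.Base using (ℕ; suc; _+_; parity)
open import Data.Nat.DivMod using (_mod_)
open import Data.Parity.Base using (Parity; 0ℙ; 1ℙ)
open import Data.Fin.Base using (Fin; toℕ; _↑ˡ_; _↑ʳ_)
open import Data.Fin.Properties using (nonZeroIndex)
open import Data.Fin.Subset using (Subset; ⊤; ∁; _-_; ∣_∣; _∈_; _∉_; _⊆_)
open import Data.Fin.Subset.Properties using (⊆-max; x∈p∧x≢y⇒x∈p-y)
open import Data.Vec.Base using (_++_)
open import Data.Product.Base using (∃; ∃-syntax; _×_; _,_; proj₁)
open import Function.Bundles using (_↔_; _⇔_; Inverse)
open import Relation.Unary using (Pred; _∪_)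
open import Relation.Binary.PropositionalEquality.Core using (_≡_; subst)

SetSystem : ℕ → Set₁
SetSystem n = Pred (Subset n) 0ℓ

Sperner : ∀ {n} → SetSystem n → Set
Sperner 𝓢 = ∀ {B C} → 𝓢 B → 𝓢 C → B ⊆ C → B ≡ C

-- Vertices are taken from an ambient set Fin n, so that a vertex can be
-- deleted without renaming the remaining ones.
record Hypergraph (n : ℕ) : Set₁ where
  field
    V   : Subset n
    E   : Pred (Subset n) 0ℓ
    E⊆V : ∀ {e} → E e → e ⊆ V

  Vertex : Set
  Vertex = ∃[ x ] x ∈ V

open Hypergraph public

hypergraph : ∀ {n} → SetSystem n → Hypergraph n
hypergraph 𝓢 = record { V = ⊤ ; E = 𝓢 ; E⊆V = λ {e} _ → ⊆-max e }

infixl 5 _−_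
_−_ : ∀ {n} → Hypergraph n → Fin n → Hypergraph n
G − v = record
  { V   = V G - v
  ; E   = λ e → E G e × v ∉ e
  ; E⊆V = λ {e} (Ge , v∉e) x∈e →
      x∈p∧x≢y⇒x∈p-y (E⊆V G Ge x∈e)
        (λ x≡v → v∉e (subst (_∈ e) x≡v x∈e))
  }

-- For e ⊆ V G and e′ ⊆ V H and a bijection φ, this says φ(e) = e′.
Maps : ∀ {m n} (G : Hypergraph m) (H : Hypergraph n) →
       Vertex G ↔ Vertex H → Subset m → Subset n → Set
Maps G H φ e e′ =
  ∀ (x : Vertex G) → proj₁ x ∈ e ⇔ proj₁ (Inverse.to φ x) ∈ e′

infix 4 _≅_
_≅_ : ∀ {m n} → Hypergraph m → Hypergraph n → Set
G ≅ H = ∃[ φ ]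
  (∀ e → E G e → ∃[ e′ ] E H e′ × Maps G H φ e e′) ×
  (∀ e′ → E H e′ → ∃[ e ] E G e × Maps G H φ e e′)

StronglyHypomorphic : ∀ {n} → Hypergraph n → Hypergraph n → Set
StronglyHypomorphic G H =
  V G ≡ V H × (∀ v → v ∈ V G → (G − v) ≅ (H − v))

-- [m] is Fin m (shifted to start at 0) and E_m is Fin (m + m): the first m
-- elements are the unprimed copies and the last m the primed ones.

unprimed : ∀ {m} → Fin m → Fin (m + m)
unprimed {m} p = p ↑ˡ m

infix 8 _′
_′ : ∀ {m} → Fin m → Fin (m + m)
_′ {m} p = m ↑ʳ p

next : ∀ {m} → Fin m → Fin m
next {m} p = _mod_ (suc (toℕ p)) m {{nonZeroIndex p}}

-- J ∪ ([m] ∖ J)′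
F : ∀ {m} → Subset m → Subset (m + m)
F J = J ++ ∁ J

𝓕 : Parity → ∀ m → SetSystem (m + m)
𝓕 π m B = ∃[ J ] parity ∣ J ∣ ≡ π × B ≡ F {m} J

𝓕₁ 𝓕₂ : ∀ m → SetSystem (m + m)
𝓕₁ = 𝓕 1ℙ
𝓕₂ = 𝓕 0ℙ

G : ∀ {m} → Fin m → Subset (m + m)
G p = ⊤ - unprimed p - p ′ - next p ′

𝓖 : ∀ m → SetSystem (m + m)
𝓖 m B = ∃[ p ] B ≡ G {m} p

𝓜₁ 𝓜₂ : ∀ m → SetSystem (m + m)
𝓜₁ m = 𝓕₁ m ∪ 𝓖 m
𝓜₂ m = 𝓕₂ m ∪ 𝓖 m

{-# OPTIONS --safe #-}

-- Sperner: F_J and its complement meet every pair {p , p′}, while G_p misses the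
-- pair of p and contains that of p − 1.
--
-- Strong hypomorphy: let q = p − 1.  Exchanging q and q′ changes the parity of J
-- in F_J, and fixes G_p (which contains both) and G_q (which contains neither).
-- These are the only blocks of 𝓖 that can avoid p or p′, so the exchange is an
-- isomorphism after deletion of either vertex.
--
-- Nonisomorphism, m ≥ 4: every block of 𝓕 misses m vertices and every block of 𝓖
-- only 3, so an isomorphism preserves 𝓖.  Since p is avoided by one block of 𝓖
-- and p′ by two, it also preserves the set [m], which is a block of exactly one
-- of 𝓜₁ and 𝓜₂.  For m = 3 all blocks have size 3; here only 𝓜₁ has a block
-- (again [m]) each of whose pairs of vertices lies in another block.
module Submission where

open import Defs
open import Data.Nat.Base using (ℕ; _≥_)
open import Data.Product.Base using (_×_)
open import Relation.Nullary.Negation.Core using (¬_)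

open import Data.Bool.Base using (true; false; not)
import Data.Bool.Properties as Bool
open import Data.Empty using (⊥-elim)
open import Data.Fin.Base using (Fin; zero; suc; toℕ; fromℕ; inject₁; splitAt)
open import Data.Fin.Permutation using (Permutation′; _⟨$⟩ʳ_; _⟨$⟩ˡ_; inverseˡ; inverseʳ; flip)
import Data.Fin.Permutation.Components as PC
open import Data.Fin.Properties
  using (_≟_; all?; any?; pigeonhole; <⇒≢; suc-injective; toℕ-injective; toℕ-fromℕ; toℕ-fromℕ<;
         toℕ-inject₁; toℕ<n; ↑ˡ-injective; ↑ʳ-injective;
         splitAt-↑ˡ; splitAt-↑ʳ; splitAt⁻¹-↑ˡ; splitAt⁻¹-↑ʳ)
open import Data.Fin.Relation.Unary.Top using (view; ‵fromℕ; ‵inject₁)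
open import Data.Fin.Subset using (Subset; ⊤; _-_; ∣_∣; _∈_; _∉_; _⊆_)
open import Data.Fin.Subset.Properties
  using (_∈?_; ∈⊤; anySubset?; ⊆-antisym; p─q⊆p; x∈p∧x≢y⇒x∈p-y)
open import Data.Nat.Base using (zero; suc; _+_; _%_; _<_; z≤n; s≤s; s<s; parity)
open import Data.Nat.DivMod using (n%n≡0; m<n⇒m%n≡m)
open import Data.Nat.Properties using (m≢1+n+m)
open import Data.Parity.Base using (Parity; 0ℙ; 1ℙ; _⁻¹)
import Data.Parity.Properties as Parity
open import Data.Product.Base using (∃; ∃-syntax; _,_; proj₁; proj₂)
open import Data.Product.Properties using (Σ-≡,≡→≡)
open import Data.Sum.Base using (_⊎_; inj₁; inj₂; reduce)
open import Data.Vec.Base using ([]; _∷_; there; lookup; tabulate; updateAt)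
open import Data.Vec.Properties
  using (≡-dec; []=⇒lookup; lookup⇒[]=; lookup∘tabulate;
         lookup-map; lookup-++ˡ; lookup-++ʳ; lookup-replicate;
         lookup∘updateAt; lookup∘updateAt′)
open import Data.Vec.Properties.WithK using ([]=-irrelevant)
open import Function.Base using (_∘_)
open import Function.Bundles using (Inverse; Equivalence; mk↔ₛ′; mk⇔)
open import Function.Definitions using (Injective)
open import Relation.Binary.PropositionalEquality
  using (_≡_; _≢_; refl; sym; trans; cong; subst; module ≡-Reasoning)
open import Relation.Nullary
  using (Dec; yes; no; contradiction; ¬?; _×-dec_; _⊎-dec_; _→-dec_)
open import Relation.Nullary.Decidable using (from-yes; from-no)
open import Relation.Unary using (Decidable; _∪_)

private variable
  m n : ℕ

-- Subsets, parity and preimages.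

subset-ext : {A B : Subset n} → (∀ x → lookup A x ≡ lookup B x) → A ≡ B
subset-ext {A = A} {B} A≗B = ⊆-antisym
  (λ {x} x∈A → lookup⇒[]= x B (trans (sym (A≗B x)) ([]=⇒lookup x∈A)))
  (λ {x} x∈B → lookup⇒[]= x A (trans (A≗B x) ([]=⇒lookup x∈B)))

lookup-∉ : {x : Fin n} {A : Subset n} → x ∉ A → lookup A x ≡ false
lookup-∉ x∉A = Bool.¬-not (x∉A ∘ lookup⇒[]= _ _)

∉-lookup : {x : Fin n} {A : Subset n} → lookup A x ≡ false → x ∉ A
∉-lookup Ax x∈A with () ← trans (sym Ax) ([]=⇒lookup x∈A)

x∉p-x : (A : Subset n) (x : Fin n) → x ∉ A - x
x∉p-x (_ ∷ A) (suc x) (there x∈) = x∉p-x A x x∈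

toggle : Subset n → Fin n → Subset n
toggle J q = updateAt J q not

parity-suc : ∀ k → parity (suc k) ≡ parity k ⁻¹
parity-suc k = trans (sym (Parity.⁻¹-involutive _)) (cong _⁻¹ (Parity.suc-homo-⁻¹ k))

parity-toggle : (J : Subset n) (q : Fin n) → parity ∣ toggle J q ∣ ≡ parity ∣ J ∣ ⁻¹
parity-toggle (true  ∷ J) zero = sym (Parity.suc-homo-⁻¹ ∣ J ∣)
parity-toggle (false ∷ J) zero = parity-suc ∣ J ∣
parity-toggle (false ∷ J) (suc q) = parity-toggle J q
parity-toggle (true  ∷ J) (suc q) = begin
  parity (suc ∣ toggle J q ∣)  ≡⟨ parity-suc ∣ toggle J q ∣ ⟩
  parity ∣ toggle J q ∣ ⁻¹     ≡⟨ cong _⁻¹ (parity-toggle J q) ⟩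
  parity ∣ J ∣ ⁻¹ ⁻¹           ≡⟨ cong _⁻¹ (parity-suc ∣ J ∣) ⟨
  parity (suc ∣ J ∣) ⁻¹        ∎
  where open ≡-Reasoning

-- Taken along the inverse of a permutation, this is the image under the permutation. Membership in
-- it is then evaluated pointwise.
preimage : (Fin m → Fin n) → Subset n → Subset m
preimage f A = tabulate (lookup A ∘ f)

lookup-preimage : (f : Fin m → Fin n) (A : Subset n) (x : Fin m) →
                  lookup (preimage f A) x ≡ lookup A (f x)
lookup-preimage f A = lookup∘tabulate (lookup A ∘ f)

∈-preimage⁺ : (f : Fin m → Fin n) {A : Subset n} {x : Fin m} → f x ∈ A → x ∈ preimage f A
∈-preimage⁺ f {A} {x} fx∈A = lookup⇒[]= x _ (trans (lookup-preimage f A x) ([]=⇒lookup fx∈A))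

∈-preimage⁻ : (f : Fin m → Fin n) {A : Subset n} {x : Fin m} → x ∈ preimage f A → f x ∈ A
∈-preimage⁻ f {A} {x} x∈ = lookup⇒[]= _ A (trans (sym (lookup-preimage f A x)) ([]=⇒lookup x∈))

preimage-injective : (σ : Permutation′ n) → Injective _≡_ _≡_ (preimage (σ ⟨$⟩ˡ_))
preimage-injective σ {A} {B} eq = ⊆-antisym (sub eq) (sub (sym eq))
  where
  sub : ∀ {A B} → preimage (σ ⟨$⟩ˡ_) A ≡ preimage (σ ⟨$⟩ˡ_) B → A ⊆ B
  sub {A} {B} eq {x} x∈A = subst (_∈ B) (inverseˡ σ)
    (∈-preimage⁻ (σ ⟨$⟩ˡ_) (subst (σ ⟨$⟩ʳ x ∈_) eq
      (∈-preimage⁺ (σ ⟨$⟩ˡ_) (subst (_∈ A) (sym (inverseˡ σ)) x∈A))))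

-- Transpositions.

transpose-comm : (i j k : Fin n) → PC.transpose i j k ≡ PC.transpose j i k
transpose-comm i j k with k ≟ i in i? | k ≟ j in j?
... | yes k≡i | yes k≡j = trans (sym k≡j) k≡i
... | yes _   | no _    rewrite i? = refl
... | no _    | yes _   rewrite j? = refl
... | no _    | no _    rewrite i? | j? = refl

-- `transpose-inverse` cancels `transpose i j` against `transpose j i`, and the two agree.
transpose-involutive : (i j k : Fin n) → PC.transpose i j (PC.transpose i j k) ≡ k
transpose-involutive i j k =
  trans (cong (PC.transpose i j) (transpose-comm i j k)) (PC.transpose-inverse i j)

transpose-left : (i j : Fin n) → PC.transpose i j i ≡ j
transpose-left i j with i ≟ i
... | yes _ = refl
... | no i≢i = contradiction refl i≢i

transpose-right : (i j : Fin n) → PC.transpose i j j ≡ i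
transpose-right i j = trans (transpose-comm i j j) (transpose-left j i)

transpose-minimal : {i j k : Fin n} → k ≢ i → k ≢ j → PC.transpose i j k ≡ k
transpose-minimal {i = i} {j} {k} k≢i k≢j with k ≟ i
... | yes k≡i = contradiction k≡i k≢i
... | no _ with k ≟ j
...   | yes k≡j = contradiction k≡j k≢j
...   | no _    = refl

preimage-transpose : {i j : Fin n} {A : Subset n} → lookup A i ≡ lookup A j →
                     preimage (PC.transpose i j) A ≡ A
preimage-transpose {i = i} {j} {A} Ai≡Aj =
  subset-ext λ x → trans (lookup-preimage _ A x) (same x)
  where
  same : ∀ x → lookup A (PC.transpose i j x) ≡ lookup A x
  same x with x ≟ i
  ... | yes refl = sym Ai≡Aj
  ... | no _ with x ≟ j
  ...   | yes refl = Ai≡Aj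
  ...   | no _     = refl

-- The cyclic successor on [m].

next-inject₁ : (k : Fin n) → next (inject₁ k) ≡ suc k
next-inject₁ {n} k = toℕ-injective (begin
  toℕ (next (inject₁ k))            ≡⟨ toℕ-fromℕ< _ ⟩
  suc (toℕ (inject₁ k)) % suc n     ≡⟨ cong (λ i → suc i % suc n) (toℕ-inject₁ k) ⟩
  suc (toℕ k) % suc n               ≡⟨ m<n⇒m%n≡m (s<s (toℕ<n k)) ⟩
  suc (toℕ k)                       ∎)
  where open ≡-Reasoning

next-fromℕ : ∀ n → next (fromℕ n) ≡ zero
next-fromℕ n = toℕ-injective (begin
  toℕ (next (fromℕ n))         ≡⟨ toℕ-fromℕ< _ ⟩
  suc (toℕ (fromℕ n)) % suc n  ≡⟨ cong (λ i → suc i % suc n) (toℕ-fromℕ n) ⟩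
  suc n % suc n                ≡⟨ n%n≡0 (suc n) ⟩
  0                            ∎)
  where open ≡-Reasoning

prev : Fin (suc n) → Fin (suc n)
prev zero    = fromℕ _
prev (suc k) = inject₁ k

next-prev : (p : Fin (suc n)) → next (prev p) ≡ p
next-prev zero    = next-fromℕ _
next-prev (suc k) = next-inject₁ k

prev-next : (p : Fin (suc n)) → prev (next p) ≡ p
prev-next p with view p
... | ‵fromℕ     = cong prev (next-fromℕ _)
... | ‵inject₁ k = cong prev (next-inject₁ k)

next-injective : Injective _≡_ _≡_ (next {suc n})
next-injective {x = p} {q} eq = trans (sym (prev-next p)) (trans (cong prev eq) (prev-next q))

suc≢inject₁ : (k : Fin n) → suc k ≢ inject₁ k
suc≢inject₁ (suc k) eq = suc≢inject₁ k (suc-injective eq)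

next≢ : (q : Fin (2 + n)) → next q ≢ q
next≢ q eq with view q
-- The top of `Fin (2 + n)` is a successor, whereas `next` wraps it round to `zero`.
... | ‵fromℕ with () ← trans (sym (next-fromℕ _)) eq
... | ‵inject₁ k = suc≢inject₁ k (trans (sym (next-inject₁ k)) eq)

-- From the top, two steps lead to 1, and from the element below it to 0; with at least three points
-- neither is the start. Everywhere else two steps add 2.
next²≢ : (q : Fin (3 + n)) → next (next q) ≢ q
next²≢ q eq with view q
... | ‵fromℕ with () ← trans (sym (next-inject₁ zero))
                        (trans (cong next (sym (next-fromℕ _))) eq)
... | ‵inject₁ k with view k
...   | ‵fromℕ with () ← trans (sym (next-fromℕ _))
                          (trans (cong next (sym (next-inject₁ k))) eq)
...   | ‵inject₁ j = m≢1+n+m (toℕ j) {1} (sym (begin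
  2 + toℕ j                                ≡⟨⟩
  toℕ (suc (suc j))                        ≡⟨ cong toℕ (next-inject₁ (suc j)) ⟨
  toℕ (next (suc (inject₁ j)))             ≡⟨ cong (toℕ ∘ next) (next-inject₁ (inject₁ j)) ⟨
  toℕ (next (next (inject₁ (inject₁ j))))  ≡⟨ cong toℕ eq ⟩
  toℕ (inject₁ (inject₁ j))                ≡⟨ toℕ-inject₁ (inject₁ j) ⟩
  toℕ (inject₁ j)                          ≡⟨ toℕ-inject₁ j ⟩
  toℕ j                                    ∎))
  where open ≡-Reasoning

-- Vertices and blocks.

data VertexView {m} : Fin (m + m) → Set where
  isUnprimed : (p : Fin m) → VertexView (unprimed p)
  isPrimed   : (p : Fin m) → VertexView (p ′)

vertexView : (x : Fin (m + m)) → VertexView x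
vertexView {m} x with splitAt m x in eq
... | inj₁ p = subst VertexView (splitAt⁻¹-↑ˡ eq) (isUnprimed p)
... | inj₂ p = subst VertexView (splitAt⁻¹-↑ʳ eq) (isPrimed p)

unprimed≢primed : {p q : Fin m} → unprimed p ≢ q ′
unprimed≢primed {m} {p} {q} eq
  with () ← trans (sym (splitAt-↑ˡ m p m)) (trans (cong (splitAt m) eq) (splitAt-↑ʳ m m q))

unprimed-injective : {p q : Fin m} → unprimed p ≡ unprimed q → p ≡ q
unprimed-injective = ↑ˡ-injective _ _ _

primed-injective : {p q : Fin m} → p ′ ≡ q ′ → p ≡ q
primed-injective = ↑ʳ-injective _ _ _

lookup-F-unprimed : (J : Subset m) (p : Fin m) → lookup (F J) (unprimed p) ≡ lookup J p
lookup-F-unprimed J p = lookup-++ˡ J _ p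

lookup-F-primed : (J : Subset m) (p : Fin m) → lookup (F J) (p ′) ≡ not (lookup J p)
lookup-F-primed J p = trans (lookup-++ʳ J _ p) (lookup-map p not J)

F-meets : (J : Subset m) (p : Fin m) → unprimed p ∈ F J ⊎ p ′ ∈ F J
F-meets J p with lookup J p in eq
... | true  = inj₁ (lookup⇒[]= _ (F J) (trans (lookup-F-unprimed J p) eq))
... | false = inj₂ (lookup⇒[]= _ (F J) (trans (lookup-F-primed J p) (cong not eq)))

F-misses : (J : Subset m) (p : Fin m) → unprimed p ∈ F J → p ′ ∉ F J
F-misses J p u∈F = ∉-lookup (trans (lookup-F-primed J p)
  (cong not (trans (sym (lookup-F-unprimed J p)) ([]=⇒lookup u∈F))))

-- `F J` contains one of `unprimed p` and `p ′` for each `p`, and `F K` never contains both, so the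
-- inclusion decides membership of `p` in `K`.
F⊆F⇒≡ : {J K : Subset m} → F J ⊆ F K → J ≡ K
F⊆F⇒≡ {J = J} {K} J⊆K = subset-ext same
  where
  same : ∀ p → lookup J p ≡ lookup K p
  same p with lookup J p in eq
  ... | true  = trans
    (sym ([]=⇒lookup (J⊆K (lookup⇒[]= _ (F J) (trans (lookup-F-unprimed J p) eq)))))
    (lookup-F-unprimed K p)
  ... | false = Bool.not-injective (trans
    (sym ([]=⇒lookup (J⊆K (lookup⇒[]= _ (F J) (trans (lookup-F-primed J p) (cong not eq))))))
    (lookup-F-primed K p))

unprimed∉G : (p : Fin m) → unprimed p ∉ G p
unprimed∉G p = x∉p-x ⊤ _ ∘ p─q⊆p _ _ ∘ p─q⊆p _ _

primed∉G : (p : Fin m) → p ′ ∉ G p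
primed∉G p = x∉p-x (⊤ - unprimed p) _ ∘ p─q⊆p _ _

next-primed∉G : (p : Fin m) → next p ′ ∉ G p
next-primed∉G p = x∉p-x (⊤ - unprimed p - p ′) _

∈-G : {p : Fin m} {x : Fin (m + m)} →
      x ≢ unprimed p → x ≢ p ′ → x ≢ next p ′ → x ∈ G p
∈-G x≢p x≢p′ x≢next =
  x∈p∧x≢y⇒x∈p-y (x∈p∧x≢y⇒x∈p-y (x∈p∧x≢y⇒x∈p-y ∈⊤ x≢p) x≢p′) x≢next

unprimed∈G : {p q : Fin m} → q ≢ p → unprimed q ∈ G p
unprimed∈G q≢p = ∈-G (q≢p ∘ unprimed-injective) unprimed≢primed unprimed≢primed

primed∈G : {p q : Fin m} → q ≢ p → q ≢ next p → q ′ ∈ G p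
primed∈G q≢p q≢next =
  ∈-G (unprimed≢primed ∘ sym) (q≢p ∘ primed-injective) (q≢next ∘ primed-injective)

unprimed∉G⇒≡ : {p q : Fin m} → unprimed q ∉ G p → q ≡ p
unprimed∉G⇒≡ {p = p} {q} q∉G with q ≟ p
... | yes q≡p = q≡p
... | no  q≢p = contradiction (unprimed∈G q≢p) q∉G

-- `unprimed q` is missing from the larger block, hence from `G p`, where the only missing unprimed
-- vertex is that of `p`.
G⊆G⇒≡ : {p q : Fin m} → G p ⊆ G q → p ≡ q
G⊆G⇒≡ {q = q} p⊆q = sym (unprimed∉G⇒≡ (unprimed∉G q ∘ p⊆q))

F⊈G : {J : Subset m} {p : Fin m} → ¬ (F J ⊆ G p)
F⊈G {J = J} {p} J⊆p with F-meets J p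
... | inj₁ u∈F = unprimed∉G p (J⊆p u∈F)
... | inj₂ p∈F = primed∉G p (J⊆p p∈F)

prev≢ : (p : Fin (3 + n)) → prev p ≢ p
prev≢ p eq = next≢ p (trans (cong next (sym eq)) (next-prev p))

-- Ensures that `prev p ′` is not the vertex `next p ′` removed from `G p`, so that `G p` contains
-- both copies of `prev p`.
prev≢next : (p : Fin (3 + n)) → prev p ≢ next p
prev≢next p eq = next²≢ p (trans (cong next (sym eq)) (next-prev p))

G⊈F : {J : Subset (3 + n)} {p : Fin (3 + n)} → ¬ (G p ⊆ F J)
G⊈F {J = J} {p} p⊆J = F-misses J (prev p)
  (p⊆J (unprimed∈G (prev≢ p))) (p⊆J (primed∈G (prev≢ p) (prev≢next p)))

-- The Sperner property.

𝓜 : Parity → ∀ m → SetSystem (m + m)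
𝓜 π m = 𝓕 π m ∪ 𝓖 m

sperner-𝓜 : (π : Parity) → Sperner (𝓜 π (3 + n))
sperner-𝓜 π (inj₁ (J , _ , refl)) (inj₁ (K , _ , refl)) B⊆C = cong F (F⊆F⇒≡ {J = J} {K} B⊆C)
sperner-𝓜 π (inj₁ (J , _ , refl)) (inj₂ (q , refl))     B⊆C = ⊥-elim (F⊈G {J = J} {q} B⊆C)
sperner-𝓜 π (inj₂ (p , refl))     (inj₁ (K , _ , refl)) B⊆C = ⊥-elim (G⊈F {J = K} {p} B⊆C)
sperner-𝓜 π (inj₂ (p , refl))     (inj₂ (q , refl))     B⊆C = cong G (G⊆G⇒≡ {p = p} {q} B⊆C)

-- Vertices carry membership proofs; as these are unique, vertices compare by their underlying
-- elements.
element-≡ : {A : Subset n} {x y : ∃ (_∈ A)} → proj₁ x ≡ proj₁ y → x ≡ y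
element-≡ eq = Σ-≡,≡→≡ (eq , []=-irrelevant _ _)

-- Strong hypomorphy.

module _ {𝓢 𝓣 : SetSystem n} {f : Fin n → Fin n} (f-involutive : ∀ x → f (f x) ≡ x)
         {v : Fin n} (fv≡v : f v ≡ v)
         (𝓢→𝓣 : ∀ {A} → 𝓢 A → v ∉ A → 𝓣 (preimage f A))
         (𝓣→𝓢 : ∀ {A} → 𝓣 A → v ∉ A → 𝓢 (preimage f A)) where

  -- Since `f` fixes `v`, it restricts to the remaining vertices. Being its own inverse, it has
  -- `preimage f` as its image map too, which supplies the matching block in both directions.
  involution⇒deletion-≅ : (hypergraph 𝓢 − v) ≅ (hypergraph 𝓣 − v)
  involution⇒deletion-≅ = mk↔ₛ′ g g g-involutive g-involutive
    , (λ A (𝓢A , v∉A) → preimage f A , (𝓢→𝓣 𝓢A v∉A , fixed v∉A) , λ (x , _) →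
         mk⇔ (∈-preimage⁺ f ∘ subst (_∈ A) (sym (f-involutive x)))
             (subst (_∈ A) (f-involutive x) ∘ ∈-preimage⁻ f))
    , (λ A (𝓣A , v∉A) → preimage f A , (𝓣→𝓢 𝓣A v∉A , fixed v∉A) , λ _ →
         mk⇔ (∈-preimage⁻ f) (∈-preimage⁺ f))
    where
    g : ∃ (_∈ ⊤ - v) → ∃ (_∈ ⊤ - v)
    -- If `f x` were `v`, then `x = f (f x) = f v = v`, which has been deleted.
    g (x , x∈) = f x , x∈p∧x≢y⇒x∈p-y ∈⊤ λ fx≡v → x∉p-x ⊤ v
      (subst (_∈ ⊤ - v) (trans (sym (f-involutive x)) (trans (cong f fx≡v) fv≡v)) x∈)

    g-involutive : ∀ x → g (g x) ≡ x
    g-involutive (x , _) = element-≡ (f-involutive x)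

    fixed : ∀ {A} → v ∉ A → v ∉ preimage f A
    fixed {A} v∉A = v∉A ∘ subst (_∈ A) fv≡v ∘ ∈-preimage⁻ f

swap : Fin m → Fin (m + m) → Fin (m + m)
swap q = PC.transpose (unprimed q) (q ′)

-- Exactly one of the two copies of `q` lies in `F J`; exchanging them puts the other one there and
-- leaves all other vertices alone.
swap-F : (J : Subset m) (q : Fin m) → preimage (swap q) (F J) ≡ F (toggle J q)
swap-F {m} J q = subset-ext λ x → trans (lookup-preimage _ (F J) x) (same x)
  where
  open ≡-Reasoning
  same : ∀ x → lookup (F J) (swap q x) ≡ lookup (F (toggle J q)) x
  same x with vertexView {m} x
  ... | isUnprimed p with p ≟ q
  ...   | yes refl = begin
    lookup (F J) (swap q (unprimed q))      ≡⟨ cong (lookup (F J)) (transpose-left (unprimed q) (q ′)) ⟩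
    lookup (F J) (q ′)                      ≡⟨ lookup-F-primed J q ⟩
    not (lookup J q)                        ≡⟨ lookup∘updateAt q J ⟨
    lookup (toggle J q) q                   ≡⟨ lookup-F-unprimed (toggle J q) q ⟨
    lookup (F (toggle J q)) (unprimed q)    ∎
  ...   | no p≢q = begin
    lookup (F J) (swap q (unprimed p))      ≡⟨ cong (lookup (F J)) (transpose-minimal
                                                 (p≢q ∘ unprimed-injective) unprimed≢primed) ⟩
    lookup (F J) (unprimed p)               ≡⟨ lookup-F-unprimed J p ⟩
    lookup J p                              ≡⟨ lookup∘updateAt′ p q p≢q J ⟨
    lookup (toggle J q) p                   ≡⟨ lookup-F-unprimed (toggle J q) p ⟨
    lookup (F (toggle J q)) (unprimed p)    ∎
  same x | isPrimed p with p ≟ q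
  ...   | yes refl = begin
    lookup (F J) (swap q (q ′))             ≡⟨ cong (lookup (F J)) (transpose-right (unprimed q) (q ′)) ⟩
    lookup (F J) (unprimed q)               ≡⟨ lookup-F-unprimed J q ⟩
    lookup J q                              ≡⟨ Bool.not-involutive _ ⟨
    not (not (lookup J q))                  ≡⟨ cong not (lookup∘updateAt q J) ⟨
    not (lookup (toggle J q) q)             ≡⟨ lookup-F-primed (toggle J q) q ⟨
    lookup (F (toggle J q)) (q ′)           ∎
  ...   | no p≢q = begin
    lookup (F J) (swap q (p ′))             ≡⟨ cong (lookup (F J)) (transpose-minimal
                                                 (unprimed≢primed ∘ sym) (p≢q ∘ primed-injective)) ⟩
    lookup (F J) (p ′)                      ≡⟨ lookup-F-primed J p ⟩
    not (lookup J p)                        ≡⟨ cong not (lookup∘updateAt′ p q p≢q J) ⟨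
    not (lookup (toggle J q) p)             ≡⟨ lookup-F-primed (toggle J q) p ⟨
    lookup (F (toggle J q)) (p ′)           ∎

swap-prev-G : {p r : Fin (3 + n)} → r ≡ p ⊎ next r ≡ p →
              preimage (swap (prev p)) (G r) ≡ G r
swap-prev-G {p = p} (inj₁ refl) = preimage-transpose (trans
  ([]=⇒lookup (unprimed∈G (prev≢ p)))
  (sym ([]=⇒lookup (primed∈G (prev≢ p) (prev≢next p)))))
-- Here `prev p` is `r` itself, and both of its copies are missing from `G r`.
swap-prev-G {r = r} (inj₂ refl) rewrite prev-next r = preimage-transpose (trans
  (lookup-∉ (unprimed∉G r)) (sym (lookup-∉ (primed∉G r))))

-- The hypothesis on `A` is what avoiding `unprimed p` and avoiding `p ′` have in common, so one
-- lemma serves both deletions.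
swap-prev-𝓜 : ∀ {π A} {p : Fin (3 + n)} → (∀ {r} → A ≡ G r → r ≡ p ⊎ next r ≡ p) →
              𝓜 π (3 + n) A → 𝓜 (π ⁻¹) (3 + n) (preimage (swap (prev p)) A)
swap-prev-𝓜 {p = p} _ (inj₁ (J , refl , refl)) =
  inj₁ (toggle J (prev p) , parity-toggle J (prev p) , swap-F J (prev p))
swap-prev-𝓜 near (inj₂ (r , refl)) = inj₂ (r , swap-prev-G (near refl))

unprimed∉⇒near : {A : Subset (m + m)} {p : Fin m} → unprimed p ∉ A →
                 ∀ {r} → A ≡ G r → r ≡ p ⊎ next r ≡ p
unprimed∉⇒near p∉A refl = inj₁ (sym (unprimed∉G⇒≡ p∉A))

-- `p ′` is removed from `G r` either as `r ′` or as `next r ′`.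
primed∉⇒near : {A : Subset (m + m)} {p : Fin m} → p ′ ∉ A →
               ∀ {r} → A ≡ G r → r ≡ p ⊎ next r ≡ p
primed∉⇒near {p = p} p′∉A {r} refl with p ≟ r | p ≟ next r
... | yes p≡r | _          = inj₁ (sym p≡r)
... | no _    | yes p≡next = inj₂ (sym p≡next)
... | no p≢r  | no p≢next  = contradiction (primed∈G p≢r p≢next) p′∉A

𝓜-stronglyHypomorphic :
  StronglyHypomorphic (hypergraph (𝓜₁ (3 + n))) (hypergraph (𝓜₂ (3 + n)))
𝓜-stronglyHypomorphic {n} = refl , λ v _ → deletion v
  where
  deletion : ∀ v → (hypergraph (𝓜₁ (3 + n)) − v) ≅ (hypergraph (𝓜₂ (3 + n)) − v)
  deletion v with vertexView {3 + n} v
  -- The swap moves only the copies of `prev p`, which differs from `p`, so the deleted vertex stays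
  -- fixed.
  ... | isUnprimed p = involution⇒deletion-≅ {f = swap (prev p)}
    (transpose-involutive (unprimed (prev p)) (prev p ′))
    (transpose-minimal (prev≢ p ∘ sym ∘ unprimed-injective)
      (unprimed≢primed {p = p} {prev p}))
    (λ A∈𝓜 p∉A → swap-prev-𝓜 {π = 1ℙ} (unprimed∉⇒near p∉A) A∈𝓜)
    (λ A∈𝓜 p∉A → swap-prev-𝓜 {π = 0ℙ} (unprimed∉⇒near p∉A) A∈𝓜)
  ... | isPrimed p = involution⇒deletion-≅ {f = swap (prev p)}
    (transpose-involutive (unprimed (prev p)) (prev p ′))
    (transpose-minimal (unprimed≢primed {p = prev p} {p} ∘ sym)
      (prev≢ p ∘ sym ∘ primed-injective {p = p}))
    (λ A∈𝓜 p∉A → swap-prev-𝓜 {π = 1ℙ} (primed∉⇒near p∉A) A∈𝓜)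
    (λ A∈𝓜 p∉A → swap-prev-𝓜 {π = 0ℙ} (primed∉⇒near p∉A) A∈𝓜)

-- Isomorphisms as permutations of the vertices.

Carries : Permutation′ n → SetSystem n → SetSystem n → Set
Carries σ 𝓢 𝓣 = ∀ {A} → 𝓢 A → 𝓣 (preimage (σ ⟨$⟩ˡ_) A)

-- Every element is a vertex through `∈⊤`, so the bijection of vertices is a permutation once
-- membership proofs are forgotten.
≅⇒permutation : {𝓢 𝓣 : SetSystem n} → hypergraph 𝓢 ≅ hypergraph 𝓣 →
                ∃[ σ ] Carries σ 𝓢 𝓣 × Carries (flip σ) 𝓣 𝓢
≅⇒permutation {n} {𝓢} {𝓣} (φ , 𝓢→𝓣 , 𝓣→𝓢) = σ , forth , back
  where
  open Inverse φ using (to; from; strictlyInverseˡ; strictlyInverseʳ)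

  σ : Permutation′ n
  σ = mk↔ₛ′ (λ x → proj₁ (to (x , ∈⊤))) (λ x → proj₁ (from (x , ∈⊤)))
    (λ x → cong proj₁ (trans (cong to (element-≡ refl)) (strictlyInverseˡ (x , ∈⊤))))
    (λ x → cong proj₁ (trans (cong from (element-≡ refl)) (strictlyInverseʳ (x , ∈⊤))))

  forth : Carries σ 𝓢 𝓣
  -- `Maps` determines `B` completely: it has the same elements as the image of `A`.
  forth {A} 𝓢A with B , 𝓣B , maps ← 𝓢→𝓣 A 𝓢A = subst 𝓣 (⊆-antisym
    (λ {x} x∈B → ∈-preimage⁺ _ (Equivalence.from (maps (from (x , ∈⊤)))
      (subst (_∈ B) (sym (cong proj₁ (strictlyInverseˡ (x , ∈⊤)))) x∈B)))
    (λ {x} x∈ → subst (_∈ B) (cong proj₁ (strictlyInverseˡ (x , ∈⊤)))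
      (Equivalence.to (maps (from (x , ∈⊤))) (∈-preimage⁻ _ x∈)))) 𝓣B

  back : Carries (flip σ) 𝓣 𝓢
  back {B} 𝓣B with A , 𝓢A , maps ← 𝓣→𝓢 B 𝓣B = subst 𝓢 (⊆-antisym
    (λ x∈A → ∈-preimage⁺ _ (Equivalence.to (maps (_ , ∈⊤)) x∈A))
    (λ x∈ → Equivalence.from (maps (_ , ∈⊤)) (∈-preimage⁻ _ x∈))) 𝓢A

-- Nonisomorphism for m ≥ 4.

G-gap : {p : Fin m} {x : Fin (m + m)} → x ∉ G p →
        ∃[ i ] x ≡ lookup (unprimed p ∷ p ′ ∷ next p ′ ∷ []) i
G-gap {p = p} {x} x∉G with x ≟ unprimed p | x ≟ p ′ | x ≟ next p ′
... | yes eq | _      | _      = zero , eq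
... | no _   | yes eq | _      = suc zero , eq
... | no _   | no _   | yes eq = suc (suc zero) , eq
... | no x≢p | no x≢p′ | no x≢next = contradiction (∈-G x≢p x≢p′ x≢next) x∉G

base : Fin (m + m) → Fin m
base {m} = reduce ∘ splitAt m

-- Yields m distinct vertices missing from `F J`, told apart by `base`, to be set against the
-- indices in `Fin 3` from `G-gap`.
F-gap : (J : Subset m) (k : Fin m) → ∃[ x ] x ∉ F J × base {m} x ≡ k
F-gap {m} J k with unprimed k ∈? F J
... | yes u∈F = k ′ , F-misses J k u∈F , cong reduce (splitAt-↑ʳ m m k)
... | no  u∉F = unprimed k , u∉F , cong reduce (splitAt-↑ˡ m k m)

-- Otherwise the inverse of `σ` would send the m vertices of `F-gap` to the three missing from
-- `G p`. Two of them would collide, although `σ` and `base` recover the index of each.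
preimage-G≢F : 3 < m → (σ : Permutation′ (m + m)) {p : Fin m} {J : Subset m} →
               preimage (σ ⟨$⟩ˡ_) (G p) ≢ F J
preimage-G≢F {m} 3<m σ {p} {J} eq =
  let i , j , i<j , same = pigeonhole 3<m (proj₁ ∘ gap)
  in <⇒≢ i<j (begin
    i                             ≡⟨ base-x i ⟨
    base {m} (x i)                ≡⟨ cong (base {m}) (inverseʳ σ) ⟨
    base {m} (σ ⟨$⟩ʳ (σ ⟨$⟩ˡ x i))  ≡⟨ cong (base {m} ∘ (σ ⟨$⟩ʳ_)) (proj₂ (gap i)) ⟩
    base {m} (σ ⟨$⟩ʳ missing (proj₁ (gap i)))
                                  ≡⟨ cong (base {m} ∘ (σ ⟨$⟩ʳ_) ∘ missing) same ⟩
    base {m} (σ ⟨$⟩ʳ missing (proj₁ (gap j)))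
                                  ≡⟨ cong (base {m} ∘ (σ ⟨$⟩ʳ_)) (proj₂ (gap j)) ⟨
    base {m} (σ ⟨$⟩ʳ (σ ⟨$⟩ˡ x j))  ≡⟨ cong (base {m}) (inverseʳ σ) ⟩
    base {m} (x j)                ≡⟨ base-x j ⟩
    j                             ∎)
  where
  open ≡-Reasoning

  x : Fin m → Fin (m + m)
  x k = proj₁ (F-gap J k)

  base-x : ∀ k → base {m} (x k) ≡ k
  base-x k = proj₂ (proj₂ (F-gap J k))

  missing : Fin 3 → Fin (m + m)
  missing = lookup (unprimed p ∷ p ′ ∷ next p ′ ∷ [])

  gap : ∀ k → ∃[ i ] σ ⟨$⟩ˡ x k ≡ missing i
  gap k = G-gap (proj₁ (proj₂ (F-gap J k)) ∘ subst (x k ∈_) eq ∘ ∈-preimage⁺ _)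

image-G : ∀ {π ρ} → 3 < m → {σ : Permutation′ (m + m)} → Carries σ (𝓜 π m) (𝓜 ρ m) →
          ∀ p → ∃[ q ] preimage (σ ⟨$⟩ˡ_) (G p) ≡ G q
image-G 3<m {σ} carries p with carries (inj₂ (p , refl))
... | inj₁ (J , _ , eq) = contradiction eq (preimage-G≢F 3<m σ {p} {J})
... | inj₂ image        = image

-- `p ′` is missing from the two blocks `G (prev p)` and `G p`. If it went to `unprimed r`, both
-- images would be `G r`, the only block of `𝓖` that misses `unprimed r`, against injectivity.
primed↛unprimed : ∀ {π ρ} → 3 < 3 + n → {σ : Permutation′ (3 + n + (3 + n))} →
                   Carries σ (𝓜 π (3 + n)) (𝓜 ρ (3 + n)) →
                   ∀ {p r : Fin (3 + n)} → σ ⟨$⟩ʳ p ′ ≢ unprimed r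
primed↛unprimed {n} 3<m {σ} carries {p} {r} σp′≡r =
  prev≢ p (G⊆G⇒≡ {p = prev p} {p} (λ {x} → subst (x ∈_) (preimage-injective σ (begin
    preimage (σ ⟨$⟩ˡ_) (G (prev p))  ≡⟨ image (subst (λ q → q ′ ∉ G (prev p))
                                          (next-prev p) (next-primed∉G (prev p))) ⟩
    G r                              ≡⟨ image (primed∉G p) ⟨
    preimage (σ ⟨$⟩ˡ_) (G p)         ∎))))
  where
  open ≡-Reasoning

  image : ∀ {q} → p ′ ∉ G q → preimage (σ ⟨$⟩ˡ_) (G q) ≡ G r
  image {q} p′∉Gq with s , eq ← image-G 3<m {σ} carries q = trans eq (cong G (sym
    (unprimed∉G⇒≡ (p′∉Gq ∘ subst (_∈ G q) (trans (cong (σ ⟨$⟩ˡ_) (sym σp′≡r)) (inverseˡ σ))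
      ∘ ∈-preimage⁻ (σ ⟨$⟩ˡ_) ∘ subst (unprimed r ∈_) (sym eq)))))

-- `F ⊤` is the set [m] of unprimed vertices. It is preserved because neither `σ` nor its inverse
-- sends a primed vertex to an unprimed one.
image-F⊤ : ∀ {π ρ} → 3 < 3 + n → {σ : Permutation′ (3 + n + (3 + n))} →
           Carries σ (𝓜 π (3 + n)) (𝓜 ρ (3 + n)) →
           Carries (flip σ) (𝓜 ρ (3 + n)) (𝓜 π (3 + n)) →
           preimage (σ ⟨$⟩ˡ_) (F (⊤ {3 + n})) ≡ F (⊤ {3 + n})
image-F⊤ {n} 3<m {σ} forth back =
  subset-ext λ x → trans (lookup-preimage (σ ⟨$⟩ˡ_) (F (⊤ {3 + n})) x) (same x)
  where
  lookup-unprimed : ∀ p → lookup (F (⊤ {3 + n})) (unprimed p) ≡ true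
  lookup-unprimed p = trans (lookup-F-unprimed ⊤ p) (lookup-replicate p true)

  lookup-primed : ∀ p → lookup (F (⊤ {3 + n})) (p ′) ≡ false
  lookup-primed p = trans (lookup-F-primed ⊤ p) (cong not (lookup-replicate p true))

  same : ∀ x → lookup (F (⊤ {3 + n})) (σ ⟨$⟩ˡ x) ≡ lookup (F (⊤ {3 + n})) x
  same x with vertexView {3 + n} x | σ ⟨$⟩ˡ x in eq
  ... | isUnprimed p | y with vertexView {3 + n} y
  ...   | isUnprimed q = trans (lookup-unprimed q) (sym (lookup-unprimed p))
  ...   | isPrimed q = contradiction
    (trans (cong (σ ⟨$⟩ʳ_) (sym eq)) (inverseʳ σ)) (primed↛unprimed 3<m {σ} forth)
  same x | isPrimed p | y with vertexView {3 + n} y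
  ...   | isUnprimed q = contradiction eq (primed↛unprimed 3<m {flip σ} back)
  ...   | isPrimed q = trans (lookup-primed q) (sym (lookup-primed p))

-- `F ⊤` is not in `𝓖`, and it arises from `J = ⊤` alone, so only the parity of m is possible.
F⊤∈𝓜⇒parity : ∀ {π} → 𝓜 π m (F (⊤ {m})) → parity ∣ ⊤ {m} ∣ ≡ π
F⊤∈𝓜⇒parity {m} (inj₁ (J , ∣J∣≡π , eq)) =
  trans (cong (parity ∘ ∣_∣) (F⊆F⇒≡ {J = ⊤ {m}} {J} (λ {x} → subst (x ∈_) eq))) ∣J∣≡π
F⊤∈𝓜⇒parity {m} (inj₂ (p , eq)) =
  ⊥-elim (F⊈G {J = ⊤ {m}} {p} (λ {x} → subst (x ∈_) eq))

𝓜-nonisomorphic-large : 3 < 3 + n → ¬ (hypergraph (𝓜₁ (3 + n)) ≅ hypergraph (𝓜₂ (3 + n)))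
𝓜-nonisomorphic-large {n} 3<m iso with ≅⇒permutation iso | parity ∣ ⊤ {3 + n} ∣ in eq
-- For odd m the block [m] is carried from `𝓜₁` into `𝓜₂`, for even m the other way; each time m
-- would get the wrong parity.
... | σ , forth , back | 1ℙ
  with () ← trans (sym eq) (F⊤∈𝓜⇒parity {3 + n} {0ℙ}
    (subst (𝓜₂ (3 + n)) (image-F⊤ {π = 1ℙ} {0ℙ} 3<m {σ} forth back) (forth (inj₁ (⊤ , eq , refl)))))
... | σ , forth , back | 0ℙ
  with () ← trans (sym eq) (F⊤∈𝓜⇒parity {3 + n} {1ℙ}
    (subst (𝓜₁ (3 + n)) (image-F⊤ {π = 0ℙ} {1ℙ} 3<m {flip σ} back forth) (back (inj₁ (⊤ , eq , refl)))))

-- Nonisomorphism for m = 3.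

PairwiseRepeated : SetSystem n → Subset n → Set
PairwiseRepeated 𝓢 B =
  ∀ x y → x ∈ B → y ∈ B → x ≢ y → ∃[ C ] 𝓢 C × C ≢ B × x ∈ C × y ∈ C

HasPairwiseRepeated : SetSystem n → Set
HasPairwiseRepeated 𝓢 = ∃[ B ] 𝓢 B × PairwiseRepeated 𝓢 B

-- A pair in the image of `B` is pulled back to `B`, and the second block found there is carried
-- forward; injectivity keeps points and blocks distinct.
HasPairwiseRepeated-carries : {σ : Permutation′ n} {𝓢 𝓣 : SetSystem n} → Carries σ 𝓢 𝓣 →
                              HasPairwiseRepeated 𝓢 → HasPairwiseRepeated 𝓣
HasPairwiseRepeated-carries {σ = σ} carries (B , 𝓢B , repeated) =
  _ , carries 𝓢B , λ x y x∈ y∈ x≢y →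
    let C , 𝓢C , C≢B , x∈C , y∈C = repeated _ _ (∈-preimage⁻ _ x∈) (∈-preimage⁻ _ y∈)
          λ eq → x≢y (trans (sym (inverseʳ σ)) (trans (cong (σ ⟨$⟩ʳ_) eq) (inverseʳ σ)))
    in _ , carries 𝓢C , C≢B ∘ preimage-injective σ , ∈-preimage⁺ _ x∈C , ∈-preimage⁺ _ y∈C

HasPairwiseRepeated? : {𝓢 : SetSystem n} → Decidable 𝓢 → Dec (HasPairwiseRepeated 𝓢)
HasPairwiseRepeated? 𝓢? = anySubset? λ B → 𝓢? B ×-dec
  all? λ x → all? λ y → x ∈? B →-dec y ∈? B →-dec ¬? (x ≟ y) →-dec
    anySubset? λ C → 𝓢? C ×-dec ¬? (≡-dec Bool._≟_ C B) ×-dec x ∈? C ×-dec y ∈? C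

𝓜? : ∀ π m → Decidable (𝓜 π m)
𝓜? π m B =
  anySubset? (λ J → parity ∣ J ∣ Parity.≟ π ×-dec ≡-dec Bool._≟_ B (F J))
  ⊎-dec any? (λ p → ≡-dec Bool._≟_ B (G p))

-- Both sides are settled by evaluating an exhaustive search over the 64 vertex subsets. In `𝓜₁` the
-- block [m] qualifies, since `G p` contains the two unprimed vertices other than that of `p`.
𝓜-nonisomorphic-3 : ¬ (hypergraph (𝓜₁ 3) ≅ hypergraph (𝓜₂ 3))
𝓜-nonisomorphic-3 iso with σ , forth , _ ← ≅⇒permutation iso =
  from-no (HasPairwiseRepeated? (𝓜? 0ℙ 3))
    (HasPairwiseRepeated-carries {σ = σ} forth (from-yes (HasPairwiseRepeated? (𝓜? 1ℙ 3))))

𝓜-nonisomorphic : ∀ n → ¬ (hypergraph (𝓜₁ (3 + n)) ≅ hypergraph (𝓜₂ (3 + n)))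
𝓜-nonisomorphic zero    = 𝓜-nonisomorphic-3
𝓜-nonisomorphic (suc n) = 𝓜-nonisomorphic-large (s≤s (s≤s (s≤s (s≤s z≤n))))

corollary7p3 : ∀ (m : ℕ) → m ≥ 3 →
    Sperner (𝓜₁ m) × Sperner (𝓜₂ m) ×
    ¬ (hypergraph (𝓜₁ m) ≅ hypergraph (𝓜₂ m)) ×
    StronglyHypomorphic (hypergraph (𝓜₁ m)) (hypergraph (𝓜₂ m))
corollary7p3 (suc (suc (suc n))) (s≤s (s≤s (s≤s z≤n))) =
  sperner-𝓜 1ℙ , sperner-𝓜 0ℙ , 𝓜-nonisomorphic n , 𝓜-stronglyHypomorphic
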